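{- Let $D$ be a connected acyclic digraph of order $n$. Then for each $i\in\{1,2,\ldots,n\}$ there exist at least $n-i+1$ connected convex sets in $D$ of order (cardinality) $i$.
   Context: All digraphs are finite; the order of a digraph is its number of vertices. A digraph is acyclic if it has no directed cycle, and connected if its underlying undirected graph is connected. A non-empty set $X$ of vertices of an acyclic digraph $D$ is connected if the underlying undirected graph of the induced subdigraph $D[X]$ is connected. A non-empty set $X$ of vertices of $D$ is convex if there is no directed path in $D$ between two vertices of $X$ that contains a vertex not in $X$. A connected convex set is a set that is both connected and convex. -}

module Defs where

open import Data.Fin.Base using (Fin)
open import Data.Fin.Subset using (Subset; _∈_; _∉_; Nonempty)
open import Data.List.Base using (List; []; _∷_)
open import Data.List.Relation.Unary.Any using (Any)
open import Data.List.Relation.Unary.Unique.Propositional using (Unique)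
open import Data.Nat.Base using (ℕ)
open import Data.Product.Base using (∃; ∃-syntax; _×_; proj₁)
open import Function.Base using (_on_)
open import Level using (0ℓ)
open import Relation.Binary.Construct.Closure.Equivalence using (EqClosure)
open import Relation.Binary.Construct.Closure.ReflexiveTransitive using (Star; ε; _◅_)
open import Relation.Binary.Core using (Rel)
open import Relation.Binary.Definitions using (Decidable)
open import Relation.Nullary.Negation.Core using (¬_)

-- A digraph of order n has vertex set Fin n.  Adjacency is decidable, as it
-- always is for a finite digraph in classical mathematics.  Loops are not
-- excluded here; a loop counts as a directed cycle in Acyclic below.
record Digraph (n : ℕ) : Set₁ where
  field
    _⟶_  : Rel (Fin n) 0ℓ
    _⟶?_ : Decidable _⟶_

-- Connectedness of the underlying undirected graph: EqClosure R x y is the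
-- type of walks from x to y that may traverse arcs in either direction.
UnderlyingConnected : {V : Set} → Rel V 0ℓ → Set
UnderlyingConnected R = ∀ x y → EqClosure R x y

module _ {n : ℕ} (D : Digraph n) where

  open Digraph D

  Walk : Rel (Fin n) 0ℓ
  Walk = Star _⟶_

  vertices : ∀ {x y} → Walk x y → List (Fin n)
  vertices {x} ε       = x ∷ []
  vertices {x} (_ ◅ w) = x ∷ vertices w

  IsPath : ∀ {x y} → Walk x y → Set
  IsPath w = Unique (vertices w)

  -- A directed cycle is a directed path from x to y closed up by an arc
  -- from y to x (a loop when x and y coincide).
  DirectedCycle : Set
  DirectedCycle = ∃[ x ] ∃[ y ] ∃[ w ] IsPath {x} {y} w × y ⟶ x

  Acyclic : Set
  Acyclic = ¬ DirectedCycle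

  Connected : Set
  Connected = UnderlyingConnected _⟶_

  -- The arcs of the induced subdigraph D[X], whose vertices are the elements
  -- of X.
  InducedArc : (X : Subset n) → Rel (∃ (_∈ X)) 0ℓ
  InducedArc X = _⟶_ on proj₁

  ConnectedSet : Subset n → Set
  ConnectedSet X = Nonempty X × UnderlyingConnected (InducedArc X)

  ConvexSet : Subset n → Set
  ConvexSet X = Nonempty X ×
    (∀ {x y} → x ∈ X → y ∈ X → (w : Walk x y) → IsPath w →
     ¬ Any (_∉ X) (vertices w))

  ConnectedConvexSet : Subset n → Set
  ConnectedConvexSet X = ConnectedSet X × ConvexSet X

-- Inside a connected convex set X, every vertex x can be avoided when deleting
-- a vertex: there is y ≢ x such that X - y is again connected and convex.  It
-- suffices that y is a source or a sink of X and that X - y is connected.  To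
-- find y, grow a connected set A containing x together with a source or sink y
-- of X outside A.  If no vertex of X other than y can be added to A and some
-- such vertices R remain, then R is separated from A by y, so a source or
-- sink of R ∪ {y} other than y is one of X; it replaces y, while y joins A.
--
-- Deleting vertices one at a time from X gives a chain from X down to size i.
-- If y is deleted from Y in this chain, then shrinking Y while avoiding y
-- yields a connected convex set of size i containing y; these sets differ from
-- all those obtained later in the chain, which do not contain y.
module Submission where

open import Defs
open import Data.Nat.Base using (ℕ; zero; suc; _+_; _∸_; _≤_)
open import Data.Nat.Properties
  using (suc-injective; m∸n+n≡m; ≤-reflexive; +-comm; m≤n+m; ≤-trans; n≮0)
open import Data.Fin.Base using (Fin)
open import Data.Fin.Properties using (_≟_; any?)
open import Data.Fin.Subset
  using (Subset; ∣_∣; _∈_; _∉_; _⊆_; _⊂_; _⊃_; Nonempty; _─_; _-_; _∪_; ⁅_⁆; inside; outside; ⊤)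
open import Data.Fin.Subset.Properties
open import Data.Fin.Subset.Induction using (Acc; acc; ⊂-wellFounded; ⊃-wellFounded)
open import Data.List.Base using (List; []; _∷_; length)
import Data.List.Membership.Propositional as List
open import Data.List.Relation.Unary.All as All using (All; []; _∷_)
open import Data.List.Relation.Unary.AllPairs using ([]; _∷_)
open import Data.List.Relation.Unary.Any using (Any; here; there)
open import Data.List.Relation.Unary.Unique.Propositional using (Unique)
open import Data.Product.Base using (Σ-syntax; ∃; ∃-syntax; _×_; _,_; proj₁; proj₂)
open import Data.Sum.Base using (_⊎_; inj₁; inj₂; [_,_])
open import Data.Vec.Base using (_∷_; here; there)
open import Data.Vec.Properties.WithK using ([]=-irrelevant)
open import Function.Base using (_∘_; id)
open import Relation.Binary.Construct.Closure.Equivalence as EqC using (EqClosure)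
open import Relation.Binary.Construct.Closure.ReflexiveTransitive using (ε; _◅_; _◅◅_)
open import Relation.Binary.Construct.Closure.Symmetric as SymC using (SymClosure; fwd; bwd)
open import Relation.Binary.PropositionalEquality
  using (_≡_; _≢_; refl; sym; trans; cong; subst; subst₂)
open import Relation.Nullary using (Dec; yes; no; ¬_; contradiction)
open import Relation.Nullary.Decidable using (_×-dec_; decidable-stable; map′; _⊎-dec_)

private
  variable
    n : ℕ

-- Adding and deleting single elements of finite subsets.

x∈p─q⇒x∉q : ∀ {x} (p q : Subset n) → x ∈ p ─ q → x ∉ q
x∈p─q⇒x∉q (_ ∷ p) (inside  ∷ q) (there x∈p─q) (there x∈q) = x∈p─q⇒x∉q p q x∈p─q x∈q
x∈p─q⇒x∉q (_ ∷ p) (outside ∷ q) (there x∈p─q) (there x∈q) = x∈p─q⇒x∉q p q x∈p─q x∈q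

x∈p-y⇒x∈p : ∀ {x} (p : Subset n) y → x ∈ p - y → x ∈ p
x∈p-y⇒x∈p p y = p─q⊆p p ⁅ y ⁆

x∈p-y⇒x≢y : ∀ {x} (p : Subset n) y → x ∈ p - y → x ≢ y
x∈p-y⇒x≢y p y = x∉⁅y⁆⇒x≢y ∘ x∈p─q⇒x∉q p ⁅ y ⁆

x∈p⇒∣p∣≡1+∣p-x∣ : ∀ {x} {p : Subset n} → x ∈ p → ∣ p ∣ ≡ suc ∣ p - x ∣
x∈p⇒∣p∣≡1+∣p-x∣ {p = _ ∷ p}       here        = cong (suc ∘ ∣_∣) (sym (p─⊥≡p p))
x∈p⇒∣p∣≡1+∣p-x∣ {p = inside ∷ _}  (there x∈p) = cong suc (x∈p⇒∣p∣≡1+∣p-x∣ x∈p)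
x∈p⇒∣p∣≡1+∣p-x∣ {p = outside ∷ _} (there x∈p) = x∈p⇒∣p∣≡1+∣p-x∣ x∈p

0<∣p∣⇒Nonempty : (p : Subset n) → 1 ≤ ∣ p ∣ → Nonempty p
0<∣p∣⇒Nonempty {n} p 0<∣p∣ with nonempty? p
... | yes ne    = ne
... | no  empty = contradiction
  (subst (1 ≤_) (trans (cong ∣_∣ (Empty-unique empty)) (∣⊥∣≡0 n)) 0<∣p∣) n≮0

x∉p⇒p⊂p∪⁅x⁆ : ∀ {x} {p : Subset n} → x ∉ p → p ⊂ p ∪ ⁅ x ⁆
x∉p⇒p⊂p∪⁅x⁆ {x = x} {p} x∉p = p⊆p∪q ⁅ x ⁆ , x , q⊆p∪q p ⁅ x ⁆ (x∈⁅x⁆ x) , x∉p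

x∈p∪⁅y⁆⁻ : ∀ {x} (p : Subset n) y → x ∈ p ∪ ⁅ y ⁆ → x ∈ p ⊎ x ≡ y
x∈p∪⁅y⁆⁻ p y x∈ with x∈p∪q⁻ p ⁅ y ⁆ x∈
... | inj₁ x∈p = inj₁ x∈p
... | inj₂ x∈y = inj₂ (x∈⁅y⁆⇒x≡y y x∈y)

module _ (D : Digraph n) where

  open Digraph D

  Adjacent : Fin n → Fin n → Set
  Adjacent = SymClosure _⟶_

  adjacent? : ∀ x y → Dec (Adjacent x y)
  adjacent? x y = map′ [ fwd , bwd ] (λ { (fwd r) → inj₁ r ; (bwd r) → inj₂ r })
    (x ⟶? y ⊎-dec y ⟶? x)

  IsSource IsSink Extreme : Subset n → Fin n → Set
  IsSource X z = ∀ {u} → u ∈ X → ¬ u ⟶ z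
  IsSink   X z = ∀ {u} → u ∈ X → ¬ z ⟶ u
  Extreme  X z = IsSource X z ⊎ IsSink X z

  -- Prefixes and neighbours along directed walks.

  head∈vertices : ∀ {x y} (w : Walk D x y) → x List.∈ vertices D w
  head∈vertices ε       = here refl
  head∈vertices (_ ◅ _) = here refl

  prefix : ∀ {x y p} (w : Walk D x y) → p List.∈ vertices D w → Walk D x p
  prefix ε       (here refl) = ε
  prefix (_ ◅ _) (here refl) = ε
  prefix (a ◅ w) (there p∈)  = a ◅ prefix w p∈

  prefix-All : ∀ {P : Fin n → Set} {x y p} (w : Walk D x y) (p∈ : p List.∈ vertices D w) →
    All P (vertices D w) → All P (vertices D (prefix w p∈))
  prefix-All ε       (here refl) ps       = ps
  prefix-All (_ ◅ _) (here refl) (p ∷ _)  = p ∷ []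
  prefix-All (_ ◅ w) (there p∈)  (p ∷ ps) = p ∷ prefix-All w p∈ ps

  prefix-IsPath : ∀ {x y p} (w : Walk D x y) (p∈ : p List.∈ vertices D w) →
    IsPath D w → IsPath D (prefix w p∈)
  prefix-IsPath ε       (here refl) uniq       = uniq
  prefix-IsPath (_ ◅ _) (here refl) _          = [] ∷ []
  prefix-IsPath (_ ◅ w) (there p∈)  (x∉ ∷ uniq) =
    prefix-All w p∈ x∉ ∷ prefix-IsPath w p∈ uniq

  predecessorOnWalk : ∀ {x y z} (w : Walk D x y) → z List.∈ vertices D w → z ≢ x →
    ∃[ u ] u List.∈ vertices D w × u ⟶ z
  predecessorOnWalk ε       (here z≡x) z≢x = contradiction z≡x z≢x
  predecessorOnWalk (_ ◅ _) (here z≡x) z≢x = contradiction z≡x z≢x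
  predecessorOnWalk {z = z} (_◅_ {j = v} a w) (there z∈) _ with z ≟ v
  ... | yes refl = _ , here refl , a
  ... | no  z≢v  = let u , u∈ , u⟶z = predecessorOnWalk w z∈ z≢v in u , there u∈ , u⟶z

  successorOnWalk : ∀ {x y z} (w : Walk D x y) → z List.∈ vertices D w → z ≢ y →
    ∃[ u ] u List.∈ vertices D w × z ⟶ u
  successorOnWalk ε       (here z≡y)  z≢y = contradiction z≡y z≢y
  successorOnWalk (a ◅ w) (here refl) _   = _ , there (head∈vertices w) , a
  successorOnWalk (_ ◅ w) (there z∈)  z≢y =
    let u , u∈ , z⟶u = successorOnWalk w z∈ z≢y in u , there u∈ , z⟶u

  -- Existence of sources and sinks.

  -- Extend a path backwards inside X; U consists of the vertices of X that it
  -- has not visited yet.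
  extendToSource : Acyclic D → ∀ {X} U → Acc _⊂_ U →
    ∀ {x y} (w : Walk D x y) → IsPath D w → x ∈ X → All (_∉ U) (vertices D w) →
    (∀ {u} → u ∈ X → u ∉ U → u List.∈ vertices D w) →
    ∃[ s ] s ∈ X × IsSource X s
  extendToSource acyclic {X} U (acc rec) {x} w path x∈X w∉U visited
    with any? (λ p → p ∈? X ×-dec p ⟶? x)
  ... | no noPred = x , x∈X , λ u∈X u⟶x → noPred (_ , u∈X , u⟶x)
  ... | yes (p , p∈X , p⟶x) with p ∈? U
  -- `p` is already on the path, so the arc from `p` to `x` closes the prefix ending at `p` to a
  -- directed cycle.
  ...   | no p∉U = contradiction
          (x , p , prefix w p∈w , prefix-IsPath w p∈w path , p⟶x) acyclic
    where p∈w = visited p∈X p∉U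
  ...   | yes p∈U = extendToSource acyclic (U - p) (rec (x∈p⇒p-x⊂p p∈U)) (p⟶x ◅ w)
          (All.map (λ { v∉U refl → v∉U p∈U }) w∉U ∷ path) p∈X
          ((λ p∈ → x∈p-y⇒x≢y U p p∈ refl) ∷ All.map (_∘ x∈p-y⇒x∈p U p) w∉U)
          visited′
    where
    visited′ : ∀ {u} → u ∈ X → u ∉ U - p → u List.∈ p ∷ vertices D w
    visited′ {u} u∈X u∉ with u ≟ p
    ... | yes u≡p = here u≡p
    ... | no  u≢p = there (visited u∈X (λ u∈U → u∉ (x∈p∧x≢y⇒x∈p-y u∈U u≢p)))

  source : Acyclic D → ∀ {X} → Nonempty X → ∃[ s ] s ∈ X × IsSource X s
  source acyclic {X} (x , x∈X) = extendToSource acyclic (X - x) (⊂-wellFounded _) ε ([] ∷ []) x∈X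
    ((λ x∈ → x∈p-y⇒x≢y X x x∈ refl) ∷ []) visited
    where
    visited : ∀ {u} → u ∈ X → u ∉ X - x → u List.∈ x ∷ []
    visited {u} u∈X u∉ with u ≟ x
    ... | yes u≡x = here u≡x
    ... | no  u≢x = contradiction (x∈p∧x≢y⇒x∈p-y u∈X u≢x) u∉

  -- A sink of X - s is a sink of X when s is a source of X.
  sink : Acyclic D → ∀ {X} → Acc _⊂_ X → Nonempty X → ∃[ t ] t ∈ X × IsSink X t
  sink acyclic {X} (acc rec) ne with source acyclic ne
  ... | s , s∈X , isSource with nonempty? (X - s)
  ...   | no empty = s , s∈X , isSink
    where
    isSink : IsSink X s
    isSink {u} u∈X s⟶u with u ≟ s
    ... | yes refl = isSource u∈X s⟶u
    ... | no  u≢s  = empty (u , x∈p∧x≢y⇒x∈p-y u∈X u≢s)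
  ...   | yes ne′ with sink acyclic (rec (x∈p⇒p-x⊂p s∈X)) ne′
  ...     | t , t∈X-s , isSink′ = t , t∈X , isSink
    where
    t∈X : t ∈ X
    t∈X = x∈p-y⇒x∈p X s t∈X-s
    isSink : IsSink X t
    isSink {u} u∈X t⟶u with u ≟ s
    ... | yes refl = isSource t∈X t⟶u
    ... | no  u≢s  = isSink′ (x∈p∧x≢y⇒x∈p-y u∈X u≢s) t⟶u

  -- A source of `R ∪ ⁅ y ⁆` that lies in `R` will do. Otherwise that source is `y`, and a sink of
  -- `R` has no arc to `y` either.
  extremeVertexAvoiding : Acyclic D → ∀ {R} → Nonempty R → ∀ y →
    ∃[ z ] z ∈ R × Extreme (R ∪ ⁅ y ⁆) z
  extremeVertexAvoiding acyclic {R} (r , r∈R) y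
    with source acyclic {R ∪ ⁅ y ⁆} (r , p⊆p∪q ⁅ y ⁆ r∈R)
  ... | s , s∈ , isSource with x∈p∪⁅y⁆⁻ R y s∈
  ...   | inj₁ s∈R = s , s∈R , inj₁ isSource
  ...   | inj₂ refl with sink acyclic {R} (⊂-wellFounded R) (r , r∈R)
  ...     | t , t∈R , isSinkR = t , t∈R , inj₂ isSink
    where
    isSink : IsSink (R ∪ ⁅ s ⁆) t
    isSink u∈ t⟶u with x∈p∪⁅y⁆⁻ R s u∈
    ... | inj₁ u∈R  = isSinkR u∈R t⟶u
    ... | inj₂ refl = isSource (p⊆p∪q ⁅ s ⁆ t∈R) t⟶u

  -- Being a source or a sink depends only on the neighbours of `z`, so it passes to any set that
  -- brings in no new ones.
  Extreme-widen : ∀ {X Y z} → (∀ {u} → u ∈ X → Adjacent u z → u ∈ Y) →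
    Extreme Y z → Extreme X z
  Extreme-widen nbrs (inj₁ isSource) = inj₁ λ u∈X u⟶z → isSource (nbrs u∈X (fwd u⟶z)) u⟶z
  Extreme-widen nbrs (inj₂ isSink)   = inj₂ λ u∈X z⟶u → isSink (nbrs u∈X (bwd z⟶u)) z⟶u

  -- Connectedness of induced subdigraphs.

  InducedConnected : Subset n → Set
  InducedConnected A = UnderlyingConnected (InducedArc D A)

  ⁅x⁆-connected : ∀ x → InducedConnected ⁅ x ⁆
  ⁅x⁆-connected x (u , u∈) (v , v∈) with x∈⁅y⁆⇒x≡y x u∈ | x∈⁅y⁆⇒x≡y x v∈
  -- Vertices of an induced subdigraph carry membership proofs, which have to be identified as well.
  ... | refl | refl = subst (λ v∈ → EqClosure _ (x , u∈) (x , v∈)) ([]=-irrelevant u∈ v∈) ε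

  ⊤-connected : Connected D → InducedConnected ⊤
  ⊤-connected connected (u , u∈) (v , v∈) =
    subst₂ (λ u∈ v∈ → EqClosure _ (u , u∈) (v , v∈))
      ([]=-irrelevant ∈⊤ u∈) ([]=-irrelevant ∈⊤ v∈)
      (EqC.gmap (λ x → x , ∈⊤) id (connected u v))

  ∪⁅⁆-connected : ∀ {A a b} → InducedConnected A → a ∈ A → Adjacent a b →
    InducedConnected (A ∪ ⁅ b ⁆)
  ∪⁅⁆-connected {A} {a} {b} conn a∈A a~b u v = toHub u ◅◅ EqC.symmetric _ (toHub v)
    where
    incl : ∃ (_∈ A) → ∃ (_∈ A ∪ ⁅ b ⁆)
    incl (x , x∈A) = x , p⊆p∪q ⁅ b ⁆ x∈A

    arc : ∀ {x y} (x∈ : x ∈ A ∪ ⁅ b ⁆) (y∈ : y ∈ A ∪ ⁅ b ⁆) → Adjacent x y →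
      SymClosure (InducedArc D (A ∪ ⁅ b ⁆)) (x , x∈) (y , y∈)
    arc _ _ (fwd r) = fwd r
    arc _ _ (bwd r) = bwd r

    toHub : ∀ u → EqClosure (InducedArc D (A ∪ ⁅ b ⁆)) u (incl (a , a∈A))
    toHub (u , u∈) with x∈p∪⁅y⁆⁻ A b u∈
    ... | inj₁ u∈A  = subst (λ u∈ → EqClosure _ (u , u∈) _) ([]=-irrelevant _ u∈)
                        (EqC.gmap incl id (conn (u , u∈A) (a , a∈A)))
    ... | inj₂ refl = arc u∈ _ (SymC.symmetric _ a~b) ◅ ε

  -- Take the first step of the walk that ends outside `A`.
  leavingEdge : ∀ {X} A {u v} → EqClosure (InducedArc D X) u v → proj₁ u ∈ A → proj₁ v ∉ A →
    ∃[ a ] ∃[ b ] a ∈ A × b ∈ X × b ∉ A × Adjacent a b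
  leavingEdge A ε u∈A v∉A = contradiction u∈A v∉A
  leavingEdge A (_◅_ {j = m , m∈X} e es) u∈A v∉A with m ∈? A
  ... | yes m∈A = leavingEdge A es m∈A v∉A
  ... | no  m∉A = _ , m , u∈A , m∈X , m∉A , SymC.gmap proj₁ id e

  -- Deleting a source or sink while keeping connectedness and convexity.

  growConnected : Acyclic D → ∀ {X} → InducedConnected X → ∀ A → Acc _⊃_ A → A ⊆ X →
    InducedConnected A → ∀ {x} → x ∈ A → ∀ {y} → y ∈ X → y ∉ A → Extreme X y →
    ∃[ z ] z ∈ X × z ≢ x × Extreme X z × InducedConnected (X - z)
  growConnected acyclic {X} connX A (acc rec) A⊆X connA {x} x∈A {y} y∈X y∉A y-ext
    with nonempty? ((X ─ A) - y)
  -- Nothing but `y` is left outside `A`, so `X - y` is `A`, which is connected.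
  ... | no empty = y , y∈X , (λ { refl → y∉A x∈A }) , y-ext ,
        subst InducedConnected (⊆-antisym A⊆X-y X-y⊆A) connA
    where
    A⊆X-y : A ⊆ X - y
    A⊆X-y a∈A = x∈p∧x≢y⇒x∈p-y (A⊆X a∈A) (λ { refl → y∉A a∈A })
    X-y⊆A : X - y ⊆ A
    X-y⊆A {v} v∈ = decidable-stable (v ∈? A) λ v∉A →
      empty (v , x∈p∧x≢y⇒x∈p-y (x∈p∧x∉q⇒x∈p─q (x∈p-y⇒x∈p X y v∈) v∉A) (x∈p-y⇒x≢y X y v∈))
  ... | yes (r , r∈R)
    with any? (λ b → b ∈? ((X ─ A) - y) ×-dec any? (λ a → a ∈? A ×-dec adjacent? a b))
  ...   | yes (b , b∈R , a , a∈A , a~b) =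
          growConnected acyclic connX (A ∪ ⁅ b ⁆) (rec (x∉p⇒p⊂p∪⁅x⁆ b∉A)) A∪b⊆X
            (∪⁅⁆-connected connA a∈A a~b) (p⊆p∪q ⁅ b ⁆ x∈A) y∈X y∉A∪b y-ext
    where
    b∈X─A : b ∈ X ─ A
    b∈X─A = x∈p-y⇒x∈p (X ─ A) y b∈R
    b∉A : b ∉ A
    b∉A = x∈p─q⇒x∉q X A b∈X─A
    A∪b⊆X : A ∪ ⁅ b ⁆ ⊆ X
    A∪b⊆X v∈ with x∈p∪⁅y⁆⁻ A b v∈
    ... | inj₁ v∈A  = A⊆X v∈A
    ... | inj₂ refl = p─q⊆p X A b∈X─A
    y∉A∪b : y ∉ A ∪ ⁅ b ⁆
    y∉A∪b y∈ with x∈p∪⁅y⁆⁻ A b y∈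
    ... | inj₁ y∈A = y∉A y∈A
    ... | inj₂ y≡b = x∈p-y⇒x≢y (X ─ A) y b∈R (sym y≡b)
  ...   | no separated
    -- `A` has no neighbour in `(X ─ A) - y`, so an edge leaving `A` on a walk to `r` can only end
    -- at `y`.
    with leavingEdge A (connX (x , A⊆X x∈A) (r , p─q⊆p X A (x∈p-y⇒x∈p (X ─ A) y r∈R))) x∈A
           (x∈p─q⇒x∉q X A (x∈p-y⇒x∈p (X ─ A) y r∈R))
       | extremeVertexAvoiding acyclic {(X ─ A) - y} (r , r∈R) y
  ...     | a , b , a∈A , b∈X , b∉A , a~b | z , z∈R , z-ext with b ≟ y
  ...       | no b≢y = contradiction
              (b , x∈p∧x≢y⇒x∈p-y (x∈p∧x∉q⇒x∈p─q b∈X b∉A) b≢y , a , a∈A , a~b) separated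
  ...       | yes refl =
              growConnected acyclic connX (A ∪ ⁅ b ⁆) (rec (x∉p⇒p⊂p∪⁅x⁆ b∉A)) A∪b⊆X
                (∪⁅⁆-connected connA a∈A a~b) (p⊆p∪q ⁅ b ⁆ x∈A) (p─q⊆p X A z∈X─A) z∉A∪b
                (Extreme-widen nbrs z-ext)
    where
    z∈X─A : z ∈ X ─ A
    z∈X─A = x∈p-y⇒x∈p (X ─ A) b z∈R
    A∪b⊆X : A ∪ ⁅ b ⁆ ⊆ X
    A∪b⊆X v∈ with x∈p∪⁅y⁆⁻ A b v∈
    ... | inj₁ v∈A  = A⊆X v∈A
    ... | inj₂ refl = b∈X
    z∉A∪b : z ∉ A ∪ ⁅ b ⁆
    z∉A∪b z∈ with x∈p∪⁅y⁆⁻ A b z∈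
    ... | inj₁ z∈A = x∈p─q⇒x∉q X A z∈X─A z∈A
    ... | inj₂ z≡b = x∈p-y⇒x≢y (X ─ A) b z∈R z≡b
    -- `z` has no neighbour in `A`, so all its neighbours in `X` lie in the set where it was chosen
    -- as a source or sink. Here `b` is the old `y`.
    nbrs : ∀ {u} → u ∈ X → Adjacent u z → u ∈ ((X ─ A) - b) ∪ ⁅ b ⁆
    nbrs {u} u∈X u~z with u ≟ b | u ∈? A
    ... | yes refl | _       = q⊆p∪q _ ⁅ b ⁆ (x∈⁅x⁆ b)
    ... | no _     | yes u∈A = contradiction (z , z∈R , u , u∈A , u~z) separated
    ... | no u≢b   | no u∉A  =
      p⊆p∪q ⁅ b ⁆ (x∈p∧x≢y⇒x∈p-y (x∈p∧x∉q⇒x∈p─q u∈X u∉A) u≢b)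

  -- A path that leaves `X - z` stays in `X` by convexity, so it passes through `z`. As `z` is
  -- neither end of it, `z` has both a predecessor and a successor in `X`.
  removeExtreme-convex : ∀ {X z} → ConvexSet D X → Extreme X z → Nonempty (X - z) →
    ConvexSet D (X - z)
  removeExtreme-convex {X} {z} (_ , convex) z-ext ne = ne , noExit
    where
    noExit : ∀ {x y} → x ∈ X - z → y ∈ X - z → (w : Walk D x y) → IsPath D w →
      ¬ Any (_∉ X - z) (vertices D w)
    noExit {x} {y} x∈ y∈ w path exit = passing z-ext
      where
      inX : ∀ {v} → v List.∈ vertices D w → v ∈ X
      inX {v} v∈w = decidable-stable (v ∈? X) λ v∉X →
        convex (x∈p-y⇒x∈p X z x∈) (x∈p-y⇒x∈p X z y∈) w path (List.lose v∈w v∉X)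
      z∈w : z List.∈ vertices D w
      z∈w with List.find exit
      ... | v , v∈w , v∉X-z with z ≟ v
      ...   | yes refl = v∈w
      ...   | no  z≢v  = contradiction (x∈p∧x≢y⇒x∈p-y (inX v∈w) (z≢v ∘ sym)) v∉X-z
      passing : ¬ Extreme X z
      passing (inj₁ isSource) =
        let u , u∈w , u⟶z = predecessorOnWalk w z∈w (x∈p-y⇒x≢y X z x∈ ∘ sym)
        in isSource (inX u∈w) u⟶z
      passing (inj₂ isSink) =
        let u , u∈w , z⟶u = successorOnWalk w z∈w (x∈p-y⇒x≢y X z y∈ ∘ sym)
        in isSink (inX u∈w) z⟶u

  removeVertexAvoiding : Acyclic D → ∀ {X x} → ConnectedConvexSet D X → x ∈ X → Nonempty (X - x) →
    ∃[ y ] y ∈ X × y ≢ x × ConnectedConvexSet D (X - y)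
  removeVertexAvoiding acyclic {X} {x} ((_ , connX) , convex) x∈X ne
    with extremeVertexAvoiding acyclic {X - x} ne x
  ... | y₀ , y₀∈ , y₀-ext
    -- The growth starts from the singleton of `x`, and `y₀` is the first candidate for deletion.
    with growConnected acyclic connX ⁅ x ⁆ (⊃-wellFounded _) ⁅x⁆⊆X (⁅x⁆-connected x) (x∈⁅x⁆ x)
           (x∈p-y⇒x∈p X x y₀∈) (x∈p─q⇒x∉q X ⁅ x ⁆ y₀∈) (Extreme-widen (λ u∈X _ → X⊆ u∈X) y₀-ext)
    where
    ⁅x⁆⊆X : ⁅ x ⁆ ⊆ X
    ⁅x⁆⊆X v∈ with x∈⁅y⁆⇒x≡y x v∈
    ... | refl = x∈X
    X⊆ : X ⊆ (X - x) ∪ ⁅ x ⁆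
    X⊆ {u} u∈X with u ≟ x
    ... | yes refl = q⊆p∪q (X - x) ⁅ x ⁆ (x∈⁅x⁆ x)
    ... | no  u≢x  = p⊆p∪q ⁅ x ⁆ (x∈p∧x≢y⇒x∈p-y u∈X u≢x)
  ...   | y , y∈X , y≢x , y-ext , conn =
          y , y∈X , y≢x , (ne′ , conn) , removeExtreme-convex convex y-ext ne′
    where
    ne′ : Nonempty (X - y)
    ne′ = x , x∈p∧x≢y⇒x∈p-y x∈X (y≢x ∘ sym)

  -- Chains of deletions and the count of sets of size `i`.

  module _ (acyclic : Acyclic D) {i : ℕ} (1≤i : 1 ≤ i) where

    removalSize : ∀ (X : Subset n) {x} d → ∣ X ∣ ≡ suc d + i → x ∈ X → ∣ X - x ∣ ≡ d + i
    removalSize X d size x∈X = suc-injective (trans (sym (x∈p⇒∣p∣≡1+∣p-x∣ x∈X)) size)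

    nonempty : ∀ (X : Subset n) d → ∣ X ∣ ≡ d + i → Nonempty X
    nonempty X d size =
      0<∣p∣⇒Nonempty X (≤-trans 1≤i (≤-trans (m≤n+m i d) (≤-reflexive (sym size))))

    -- `d` counts the deletions still to be made. While one remains, `1 ≤ i` ensures that `X` has a
    -- vertex besides `x`.
    shrinkAround : ∀ d {X x} → ∣ X ∣ ≡ d + i → ConnectedConvexSet D X → x ∈ X →
      ∃[ Y ] Y ⊆ X × x ∈ Y × ConnectedConvexSet D Y × ∣ Y ∣ ≡ i
    shrinkAround zero    {X} size cc x∈X = X , id , x∈X , cc , size
    shrinkAround (suc d) {X} {x} size cc x∈X =
      let y , y∈X , y≢x , cc′ =
            removeVertexAvoiding acyclic cc x∈X (nonempty (X - x) d (removalSize X d size x∈X))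
          Y , Y⊆X-y , x∈Y , good =
            shrinkAround d (removalSize X d size y∈X) cc′ (x∈p∧x≢y⇒x∈p-y x∈X (y≢x ∘ sym))
      in Y , (λ v∈Y → x∈p-y⇒x∈p X y (Y⊆X-y v∈Y)) , x∈Y , good

    -- The inclusion `Y ⊆ X` is carried along for distinctness: sets found inside `X - y` cannot
    -- contain `y`.
    connectedConvexSubsets : ∀ d {X} → ∣ X ∣ ≡ d + i → ConnectedConvexSet D X →
      Σ[ Ys ∈ List (Subset n) ]
        Unique Ys × All (λ Y → Y ⊆ X × ConnectedConvexSet D Y × ∣ Y ∣ ≡ i) Ys × length Ys ≡ suc d
    connectedConvexSubsets zero {X} size cc =
      X ∷ [] , [] ∷ [] , (id , cc , size) ∷ [] , refl
    connectedConvexSubsets (suc d) {X} size cc@(((x , x∈X) , _) , _) =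
      -- The avoided vertex `x` is arbitrary; the aim is some deletable `y`.
      let y , y∈X , _ , cc′ =
            removeVertexAvoiding acyclic cc x∈X (nonempty (X - x) d (removalSize X d size x∈X))
          -- The new set is obtained from `X` itself, by deletions that spare `y`.
          Y , Y⊆X , y∈Y , goodY = shrinkAround (suc d) size cc y∈X
          Ys , unique , good , len = connectedConvexSubsets d (removalSize X d size y∈X) cc′
      in Y ∷ Ys
       , All.map (λ { (Z⊆X-y , _) refl → x∈p-y⇒x≢y X y (Z⊆X-y y∈Y) refl }) good ∷ unique
       , ((λ {v} → Y⊆X {v}) , goodY)
           ∷ All.map (λ (Z⊆X-y , goodZ) → (λ {v} v∈Z → x∈p-y⇒x∈p X y (Z⊆X-y {v} v∈Z)) , goodZ) good
       , cong suc len

theorem3p3 : (n : ℕ) (D : Digraph n) → Connected D → Acyclic D →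
    (i : ℕ) → 1 ≤ i → i ≤ n →
    Σ[ Xs ∈ List (Subset n) ]
    (Unique Xs × All (λ X → ConnectedConvexSet D X × ∣ X ∣ ≡ i) Xs × n ∸ i + 1 ≤ length Xs)
theorem3p3 n D connected acyclic i 1≤i i≤n =
  -- From the full vertex set, `n ∸ i` deletions reach size `i`; counting both ends, the chain has
  -- `suc (n ∸ i)` members, each giving one set.
  let Xs , unique , good , len = connectedConvexSubsets D acyclic 1≤i (n ∸ i) size
        ((⊤-nonempty , ⊤-connected D connected) , ⊤-nonempty , ⊤-convex)
  in Xs , unique , All.map proj₂ good , ≤-reflexive (trans (+-comm (n ∸ i) 1) (sym len))
  where
  size : ∣ ⊤ {n} ∣ ≡ n ∸ i + i
  size = trans (∣⊤∣≡n n) (sym (m∸n+n≡m i≤n))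
  ⊤-nonempty : Nonempty (⊤ {n})
  ⊤-nonempty = nonempty D acyclic 1≤i ⊤ (n ∸ i) size
  ⊤-convex : ∀ {x y} → x ∈ ⊤ → y ∈ ⊤ → (w : Walk D x y) → IsPath D w → ¬ Any (_∉ ⊤) (vertices D w)
  ⊤-convex _ _ w _ exit = let _ , _ , v∉⊤ = List.find exit in v∉⊤ ∈⊤
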